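{- Let $S$ be a recurrent specular set on a finite alphabet $A$. The even code of $S$ is an $S$-maximal bifix code of $S$-degree $2$.
   Context: Words are over a finite alphabet $A$; $\varepsilon$ is the empty word. A set $S$ of words on $A$ is factorial if it contains $A$ and all the factors of its elements. For $w\in S$ let $L(w)=\{a\in A\mid aw\in S\}$, $R(w)=\{a\in A\mid wa\in S\}$, $B(w)=\{(a,b)\in A\times A\mid awb\in S\}$. A factorial set $S$ is biextendable if $B(w)\neq\emptyset$ for all $w\in S$. The extension graph $\mathcal{E}(w)$ is the undirected graph whose vertex set is the disjoint union of $L(w)$ and $R(w)$ and whose edges are the pairs in $B(w)$. A biextendable set $S$ is a tree set of characteristic $c$ if $\mathcal{E}(w)$ is a tree for every nonempty $w\in S$ and $\mathcal{E}(\varepsilon)$ is a disjoint union of $c$ trees. Let $\theta$ be an involution on $A$ (possibly with fixed points) and let $G_\theta$ be the group generated by $A$ with relations $a\theta(a)=1$, $a\in A$ (so $a^{ -1}=\theta(a)$). A word is reduced if it has no factor $a\theta(a)$ with $a\in A$; the inverse of a reduced word $a_1\cdots a_n$ is the reduced word $\theta(a_n)\cdots\theta(a_1)$. A laminary set on $A$ relative to $\theta$ is a biextendable set of reduced words closed under taking inverses. A specular set is a laminary set which is a tree set of characteristic $2$. A set $S\ne\{\varepsilon\}$ is recurrent if it is factorial and for all $u,w\in S$ there is $v\in S$ with $uvw\in S$. In a specular set, each letter $a$ occurs exactly twice as a vertex of $\mathcal{E}(\varepsilon)$, once in $L(\varepsilon)$ and once in $R(\varepsilon)$; $a$ is even if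 both occurrences are in the same tree of $\mathcal{E}(\varepsilon)$ and odd otherwise. A word of $S$ is even if it has an even number of (occurrences of) odd letters, and odd otherwise. The even code is the set of nonempty even words of $S$ without a proper nonempty even prefix. A bifix code is a set of nonempty words in which no element is a proper prefix or a proper suffix of another. A bifix code $X\subset S$ is $S$-maximal if it is not properly contained in a bifix code $Y\subset S$. A parse of a word $w$ with respect to $X$ is a triple $(q,x,p)$ with $w=qxp$, where $q$ has no suffix in $X$, $x\in X^*$ and $p$ has no prefix in $X$. The $S$-degree of $X$ is the maximal number of parses with respect to $X$ of a word of $S$. -}

module Defs where

open import Level using (0ℓ)
open import Data.Empty using (⊥)
open import Data.Fin using (Fin)
import Data.Fin.Properties as Fin
open import Data.List using (List; []; _∷_; _++_; _∷ʳ_; [_]; concat; filter; length; map; reverse)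
open import Data.List.Relation.Binary.Infix.Heterogeneous using (Infix)
open import Data.List.Relation.Binary.Prefix.Heterogeneous using (Prefix)
open import Data.List.Relation.Binary.Suffix.Heterogeneous using (Suffix)
open import Data.List.Relation.Unary.All using (All)
open import Data.List.Relation.Unary.Linked using (Linked)
open import Data.List.Relation.Unary.Unique.Propositional using (Unique)
import Data.List.Membership.Propositional as List
open import Data.Nat using (ℕ; _≤_)
open import Data.Nat.Divisibility using (_∣_)
open import Data.Product using (Σ-syntax; ∃-syntax; _×_; _,_; proj₁; proj₂)
open import Data.Sum using (_⊎_; inj₁; inj₂)
open import Function.Bundles using (_⇔_)
open import Relation.Binary.Construct.Closure.ReflexiveTransitive using (Star)
open import Relation.Binary.Core using (Rel)
open import Relation.Binary.PropositionalEquality using (_≡_; _≢_; refl; sym; trans; subst)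
open import Relation.Nullary using (¬_; Dec; ¬?)
open import Relation.Nullary.Decidable using (map′)
open import Relation.Unary using (Pred; _∈_; _⊆_; _≐_; Satisfiable; ｛_｝; _⟨⊎⟩_)

------------------------------------------------------------------------
-- Graphs

-- A graph is given by a set V of vertices in a type U and a symmetric
-- relation E on U.  All notions below concern the subgraph induced on V,
-- so E may relate points outside V.

module _ {U : Set} (V : Pred U 0ℓ) (E : Rel U 0ℓ) where

  Adjacent : Rel U 0ℓ
  Adjacent u v = u ∈ V × v ∈ V × E u v

  Connected : Set
  Connected = ∀ {u v} → u ∈ V → v ∈ V → Star Adjacent u v

  -- The cycle u – v₁ – ⋯ – vₖ – u through the distinct vertices u ∷ vs,
  -- of which there are at least three.
  record IsCycle (u : U) (vs : List U) : Set where
    field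
      distinct : Unique (u ∷ vs)
      long     : 2 ≤ length vs
      closed   : Linked Adjacent (u ∷ vs ∷ʳ u)

  Acyclic : Set
  Acyclic = ∀ u vs → ¬ IsCycle u vs

  record IsTree : Set where
    field
      nonempty  : Satisfiable V
      connected : Connected
      acyclic   : Acyclic

record IsDisjointUnionOfTrees {U : Set} (V : Pred U 0ℓ) (E : Rel U 0ℓ) (c : ℕ) : Set₁ where
  field
    tree       : Fin c → Pred U 0ℓ
    tree⊆V     : ∀ i → tree i ⊆ V
    cover      : ∀ {u} → u ∈ V → ∃[ i ] u ∈ tree i
    disjoint   : ∀ {i j u} → u ∈ tree i → u ∈ tree j → i ≡ j
    noCrossing : ∀ {i j u v} → u ∈ tree i → v ∈ tree j → E u v → i ≡ j
    isTree     : ∀ i → IsTree (tree i) E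

module _ {A : Set} where

  ----------------------------------------------------------------------
  -- Sets of words

  Word : Set
  Word = List A

  Words : Set₁
  Words = Pred Word 0ℓ

  record IsFactorial (S : Words) : Set where
    field
      letter : ∀ a → [ a ] ∈ S
      factor : ∀ {u w} → Infix _≡_ u w → w ∈ S → u ∈ S

  module _ (S : Words) where

    L : Word → Pred A 0ℓ
    L w a = a ∷ w ∈ S

    R : Word → Pred A 0ℓ
    R w a = w ∷ʳ a ∈ S

    B : Word → Pred (A × A) 0ℓ
    B w (a , b) = a ∷ w ∷ʳ b ∈ S

    -- In the extension graph, inj₁ a is the vertex a of L w and inj₂ a is
    -- the vertex a of R w.

    Vertex : Word → Pred (A ⊎ A) 0ℓ
    Vertex w = L w ⟨⊎⟩ R w

    Edge : Word → Rel (A ⊎ A) 0ℓ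
    Edge w (inj₁ a) (inj₂ b) = (a , b) ∈ B w
    Edge w (inj₂ b) (inj₁ a) = (a , b) ∈ B w
    Edge w (inj₁ _) (inj₁ _) = ⊥
    Edge w (inj₂ _) (inj₂ _) = ⊥

  record IsBiextendable (S : Words) : Set where
    field
      isFactorial : IsFactorial S
      extend      : ∀ {w} → w ∈ S → Satisfiable (B S w)

    open IsFactorial isFactorial public

  record IsTreeSet (S : Words) (c : ℕ) : Set₁ where
    field
      isBiextendable : IsBiextendable S
      tree-nonempty  : ∀ {w} → w ∈ S → w ≢ [] → IsTree (Vertex S w) (Edge S w)
      trees-empty    : IsDisjointUnionOfTrees (Vertex S []) (Edge S []) c

  record IsRecurrent (S : Words) : Set where
    field
      nontrivial  : ¬ (S ≐ ｛ [] ｝)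
      isFactorial : IsFactorial S
      recurrent   : ∀ {u w} → u ∈ S → w ∈ S → ∃[ v ] (v ∈ S × u ++ v ++ w ∈ S)

  ----------------------------------------------------------------------
  -- Specular sets

  module _ (θ : A → A) where

    Reduced : Words
    Reduced w = ∀ a → ¬ Infix _≡_ (a ∷ θ a ∷ []) w

    inverse : Word → Word
    inverse w = reverse (map θ w)

    record IsLaminary (S : Words) : Set where
      field
        isBiextendable : IsBiextendable S
        reduced        : S ⊆ Reduced
        inverse-closed : ∀ {w} → w ∈ S → inverse w ∈ S

    record IsSpecular (S : Words) : Set₁ where
      field
        isLaminary : IsLaminary S
        isTreeSet  : IsTreeSet S 2

      open IsLaminary isLaminary public
      open IsTreeSet isTreeSet public using (tree-nonempty; trees-empty)
      open IsBiextendable isBiextendable public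

  ----------------------------------------------------------------------
  -- Bifix codes

  ProperPrefix : Rel Word 0ℓ
  ProperPrefix u w = Prefix _≡_ u w × u ≢ w

  ProperSuffix : Rel Word 0ℓ
  ProperSuffix u w = Suffix _≡_ u w × u ≢ w

  record IsBifixCode (X : Words) : Set where
    field
      nonempty   : ∀ {x} → x ∈ X → x ≢ []
      prefixFree : ∀ {x y} → x ∈ X → y ∈ X → ¬ ProperPrefix x y
      suffixFree : ∀ {x y} → x ∈ X → y ∈ X → ¬ ProperSuffix x y

  -- Maximality is stated positively: constructively, this is stronger than
  -- the absence of a bifix code Y ⊆ S with X ⊂ Y.
  record IsMaximalBifixCode (S X : Words) : Set₁ where
    field
      isBifixCode : IsBifixCode X
      included    : X ⊆ S
      maximal     : ∀ (Y : Words) → IsBifixCode Y → Y ⊆ S → X ⊆ Y → Y ⊆ X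

  -- The submonoid X* generated by X.
  Submonoid : Words → Words
  Submonoid X w = Σ[ xs ∈ List Word ] (All X xs × concat xs ≡ w)

  record IsParse (X : Words) (w : Word) (t : Word × Word × Word) : Set where
    q = proj₁ t
    x = proj₁ (proj₂ t)
    p = proj₂ (proj₂ t)
    field
      splits   : w ≡ q ++ x ++ p
      noSuffix : ∀ {s} → Suffix _≡_ s q → ¬ (s ∈ X)
      middle   : x ∈ Submonoid X
      noPrefix : ∀ {s} → Prefix _≡_ s p → ¬ (s ∈ X)

  -- The word w has exactly k parses: they are enumerated without repetition
  -- by a list of length k.
  HasParses : Words → Word → ℕ → Set
  HasParses X w k =
    Σ[ ts ∈ List (Word × Word × Word) ]
      (Unique ts × (∀ t → t List.∈ ts ⇔ IsParse X w t) × length ts ≡ k)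

  record HasDegree (S X : Words) (d : ℕ) : Set where
    field
      bounded  : ∀ {w} → w ∈ S → ∃[ k ] (HasParses X w k × k ≤ d)
      attained : ∃[ w ] (w ∈ S × HasParses X w d)

  ----------------------------------------------------------------------
  -- The even code of a specular set

  module _ {θ : A → A} {S : Words} (specular : IsSpecular θ S) where

    open IsSpecular specular
    open IsDisjointUnionOfTrees trees-empty

    -- The trees of the extension graph of [] are its connected components, so
    -- evenness does not depend on the decomposition recorded in trees-empty.
    EvenLetter : Pred A 0ℓ
    EvenLetter a = ∃[ i ] (inj₁ a ∈ tree i × inj₂ a ∈ tree i)

    OddLetter : Pred A 0ℓ
    OddLetter a = ¬ EvenLetter a

    evenLetter? : ∀ a → Dec (EvenLetter a)
    evenLetter? a with cover {inj₁ a} (letter a) | cover {inj₂ a} (letter a)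
    ... | i , a∈i | j , a∈j =
      map′ (λ i≡j → i , a∈i , subst (λ k → inj₂ a ∈ tree k) (sym i≡j) a∈j)
           (λ (k , a∈k , a∈k′) → trans (disjoint a∈i a∈k) (disjoint a∈k′ a∈j))
           (i Fin.≟ j)

    oddLetter? : ∀ a → Dec (OddLetter a)
    oddLetter? a = ¬? (evenLetter? a)

    EvenWord : Words
    EvenWord w = w ∈ S × 2 ∣ length (filter oddLetter? w)

    record EvenCode (w : Word) : Set where
      field
        even     : w ∈ EvenWord
        nonempty : w ≢ []
        minimal  : ∀ {u} → ProperPrefix u w → u ≢ [] → ¬ (u ∈ EvenWord)

{-# OPTIONS --safe #-}
-- By recurrence, every u ∈ S has some u v u ∈ S, and one of u, u v and u v u is
-- even; so every nonempty word of S is comparable for the prefix order with a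
-- word of the even code X, which makes X maximal.
--
-- A word of S has no suffix (prefix) in X exactly when it has no nonempty even
-- suffix (prefix).  Two prefixes of w of the same parity differ by an even word,
-- so a parse (q , x , p) of w is determined by the parity of q.  The even parse
-- has q = ε, and the odd one, with q the shortest odd prefix of w, exists as soon
-- as w contains an odd letter.
--
-- Finally some letter is odd: otherwise no word of S would lead from a letter in
-- one tree of the extension graph of ε to a letter in the other.
module Submission where

open import Defs
open import Data.Empty using (⊥-elim)
open import Data.Fin using (Fin; zero; suc)
open import Data.List using (List; []; _∷_; _++_; [_]; concat; filter; length)
open import Data.List.Properties
  using (++-assoc; ++-identityʳ; ++-identityʳ-unique; filter-++; filter-accept; length-++; ∷-injective)
open import Data.List.Relation.Binary.Infix.Heterogeneous using (here; _++ⁱ_)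
open import Data.List.Relation.Binary.Pointwise using ([])
open import Data.List.Relation.Binary.Prefix.Heterogeneous using (Prefix; []; _∷_)
open import Data.List.Relation.Binary.Prefix.Propositional.Properties using (∣ˡ-as-Prefix)
open import Data.List.Relation.Binary.Suffix.Heterogeneous using (Suffix; here; _++ˢ_)
open import Data.List.Relation.Binary.Suffix.Propositional.Properties using (Suffix-as-∣ʳ; ∣ʳ-as-Suffix)
open import Data.List.Relation.Unary.All using (All; []; _∷_; all?)
open import Data.List.Relation.Unary.All.Properties using (¬All⇒Any¬)
open import Data.List.Relation.Unary.AllPairs using ([]; _∷_)
import Data.List.Relation.Unary.Any as Any
import Algebra.Definitions.RawMagma as Magma
open import Data.Nat using (ℕ; zero; suc; _+_; _≤_; _<_; z≤n; s≤s)
open import Data.Nat.Divisibility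
  using (_∣_; _∣?_; _∣0; ∣-refl; ∣m∣n⇒∣m+n; ∣m+n∣m⇒∣n; ∣1⇒≡1)
open import Data.Nat.Induction using (Acc; acc; <-wellFounded)
open import Data.Nat.Properties using (+-comm; +-suc; m≤n+m)
open import Data.Product using (∃; ∃₂; ∃-syntax; _×_; _,_; proj₁; proj₂)
open import Data.Sum using (_⊎_; inj₁; inj₂)
open import Function using (_∘_)
open import Function.Bundles using (_↔_; mk⇔)
open import Algebra.Definitions using (Involutive)
open import Level using (0ℓ)
open import Relation.Binary.PropositionalEquality
  using (_≡_; _≢_; refl; sym; trans; cong; cong₂; subst)
open import Relation.Nullary using (¬_; Dec; yes; no; ¬?; contradiction)
open import Relation.Nullary.Decidable using (_×-dec_)
open import Relation.Unary using (Pred; Decidable; _∈_; _⊆_)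

odd⇒even-suc : ∀ n → ¬ 2 ∣ n → 2 ∣ suc n
odd⇒even-suc zero          odd = contradiction (2 ∣0) odd
odd⇒even-suc (suc zero)    odd = ∣-refl
odd⇒even-suc (suc (suc n)) odd =
  ∣m∣n⇒∣m+n ∣-refl (odd⇒even-suc n (odd ∘ ∣m∣n⇒∣m+n ∣-refl))

odd+odd⇒even : ∀ m n → ¬ 2 ∣ m → ¬ 2 ∣ n → 2 ∣ m + n
odd+odd⇒even m n odd-m odd-n = ∣m+n∣m⇒∣n
  (subst (2 ∣_) (cong suc (+-suc m n)) (∣m∣n⇒∣m+n (odd⇒even-suc m odd-m) (odd⇒even-suc n odd-n)))
  ∣-refl

module _ {A : Set} where

  nonempty? : Decidable {A = List A} (_≢ [])
  nonempty? []      = no λ []≢[] → []≢[] refl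
  nonempty? (_ ∷ _) = yes λ ()

  ++⇒prefix : ∀ {u w : List A} → (∃[ v ] u ++ v ≡ w) → Prefix _≡_ u w
  ++⇒prefix (v , eq) = ∣ˡ-as-Prefix (v Magma., eq)

  prefix-++ : ∀ (u : List A) {v} → Prefix _≡_ u (u ++ v)
  prefix-++ u {v} = ++⇒prefix (v , refl)

  prefix-refl : ∀ (u : List A) → Prefix _≡_ u u
  prefix-refl u = ++⇒prefix ([] , ++-identityʳ u)

  ++⇒suffix : ∀ {v w : List A} → (∃[ u ] u ++ v ≡ w) → Suffix _≡_ v w
  ++⇒suffix (u , eq) = ∣ʳ-as-Suffix (u Magma., eq)

  suffix⇒++ : ∀ {v w : List A} → Suffix _≡_ v w → ∃[ u ] u ++ v ≡ w
  suffix⇒++ v≤w with u Magma., eq ← Suffix-as-∣ʳ v≤w = u , eq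

  properPrefix-++ : ∀ (u : List A) {v} → v ≢ [] → ProperPrefix u (u ++ v)
  properPrefix-++ u v≢[] = prefix-++ u , v≢[] ∘ ++-identityʳ-unique u

  first-prefix : {P : Pred (List A) 0ℓ} → Decidable P → ∀ w →
    (∃₂ λ x t → x ++ t ≡ w × P x × (∀ {u} → ProperPrefix u x → ¬ P u))
    ⊎ (∀ {u} → Prefix _≡_ u w → ¬ P u)
  first-prefix P? w with P? []
  first-prefix P? w       | yes p =
    inj₁ ([] , w , refl , p , λ { ([] , []≢[]) → ⊥-elim ([]≢[] refl) })
  first-prefix P? []      | no ¬p = inj₂ λ { [] → ¬p }
  first-prefix P? (a ∷ w) | no ¬p with first-prefix (P? ∘ (a ∷_)) w
  ... | inj₁ (x , t , refl , px , min) = inj₁ (a ∷ x , t , refl , px , λ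
    { ([] , _)            → ¬p
    ; (refl ∷ u≤x , u≢x) → min (u≤x , u≢x ∘ cong (a ∷_)) })
  ... | inj₂ none = inj₂ λ { [] → ¬p ; (refl ∷ u≤w) → none u≤w }

  split-unique : ∀ u u′ {v v′ : List A} → u ++ v ≡ u′ ++ v′ →
    (∀ d → u ++ d ≡ u′ → v ≡ d ++ v′ → d ≡ []) →
    (∀ d → u′ ++ d ≡ u → v′ ≡ d ++ v → d ≡ []) →
    u ≡ u′ × v ≡ v′
  split-unique []      []       eq f g = refl , eq
  split-unique []      (b ∷ u′) eq f g = contradiction (f _ refl eq) λ ()
  split-unique (a ∷ u) []       eq f g = contradiction (g _ refl (sym eq)) λ ()
  split-unique (a ∷ u) (b ∷ u′) eq f g with refl , eq′ ← ∷-injective eq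
    with u≡u′ , v≡v′ ← split-unique u u′ eq′
                         (λ d → f d ∘ cong (a ∷_)) (λ d → g d ∘ cong (a ∷_))
    = cong (a ∷_) u≡u′ , v≡v′

  last-factor : {X : Words} (xs : List (List A)) → All X xs → concat xs ≢ [] →
    ∃[ x ] (X x × Suffix _≡_ x (concat xs))
  last-factor []       []         ne = contradiction refl ne
  last-factor (x ∷ xs) (x∈X ∷ xs⊆X) ne with nonempty? (concat xs)
  ... | yes ne′ with y , y∈X , suf ← last-factor xs xs⊆X ne′ = y , y∈X , x ++ˢ suf
  ... | no ¬ne with concat xs
  ...   | []    = x , x∈X , ++⇒suffix ([] , sym (++-identityʳ x))
  ...   | _ ∷ _ = contradiction (λ ()) ¬ne

  bifix-split : {Y : Words} → IsBifixCode Y →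
    ∀ {x y d : List A} → x ∈ Y → y ∈ Y → x ++ d ≡ y → d ≡ []
  bifix-split bifix {d = []}    _   _   _    = refl
  bifix-split bifix {d = _ ∷ _} x∈Y y∈Y refl =
    contradiction (properPrefix-++ _ λ ()) (IsBifixCode.prefixFree bifix x∈Y y∈Y)

module _ {A : Set} {θ : A → A} {S : Pred (List A) 0ℓ} (specular : IsSpecular θ S) where

  open IsSpecular specular
  open IsDisjointUnionOfTrees trees-empty

  private
    X : Words
    X = EvenCode specular

    odd? : Decidable (OddLetter specular)
    odd? = oddLetter? specular

  Even : Pred (List A) 0ℓ
  Even w = 2 ∣ length (filter odd? w)

  even? : Decidable Even
  even? w = 2 ∣? length (filter odd? w)

  length-filter-++ : ∀ u v →
    length (filter odd? (u ++ v)) ≡ length (filter odd? u) + length (filter odd? v)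
  length-filter-++ u v =
    trans (cong length (filter-++ odd? u v)) (length-++ (filter odd? u))

  even-++ : ∀ u v → Even u → Even v → Even (u ++ v)
  even-++ u v eu ev = subst (2 ∣_) (sym (length-filter-++ u v)) (∣m∣n⇒∣m+n eu ev)

  even-++⁻ʳ : ∀ u v → Even (u ++ v) → Even u → Even v
  even-++⁻ʳ u v euv = ∣m+n∣m⇒∣n (subst (2 ∣_) (length-filter-++ u v) euv)

  even-++⁻ˡ : ∀ u v → Even (u ++ v) → Even v → Even u
  even-++⁻ˡ u v euv =
    ∣m+n∣m⇒∣n (subst (2 ∣_) (trans (length-filter-++ u v) (+-comm _ (length (filter odd? v)))) euv)

  odd-++ : ∀ u v → ¬ Even u → ¬ Even v → Even (u ++ v)
  odd-++ u v ou ov = subst (2 ∣_) (sym (length-filter-++ u v)) (odd+odd⇒even _ _ ou ov)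

  even-difference : ∀ u d → (Even u → Even (u ++ d)) → (Even (u ++ d) → Even u) → Even d
  even-difference u d to from with even? u | even? d
  ... | yes eu | _      = even-++⁻ʳ u d (to eu) eu
  ... | no _   | yes ed = ed
  ... | no ou  | no od  = contradiction (from (odd-++ u d ou od)) ou

  prefix∈S : ∀ u {v} → u ++ v ∈ S → u ∈ S
  prefix∈S u = factor (here (prefix-++ u))

  suffix∈S : ∀ u {v} → u ++ v ∈ S → v ∈ S
  suffix∈S u {v} = factor (u ++ⁱ here (prefix-refl v))

  first-code-word : ∀ {w} → w ∈ S →
    (∃₂ λ x t → x ++ t ≡ w × x ∈ X)
    ⊎ (∀ {u} → Prefix _≡_ u w → ¬ (u ≢ [] × Even u))
  first-code-word {w} w∈S with first-prefix (λ u → nonempty? u ×-dec even? u) w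
  ... | inj₂ none = inj₂ none
  ... | inj₁ (x , t , refl , (x≢[] , ex) , min) = inj₁ (x , t , refl , record
    { even     = prefix∈S x w∈S , ex
    ; nonempty = x≢[]
    ; minimal  = λ u<x u≢[] (_ , eu) → min u<x (u≢[] , eu)
    })

  code-prefix : ∀ {w} → w ∈ S → w ≢ [] → Even w → ∃₂ λ x t → x ++ t ≡ w × x ∈ X
  code-prefix {w} w∈S w≢[] ew with first-code-word w∈S
  ... | inj₁ found = found
  ... | inj₂ none  =
    contradiction (w≢[] , ew) (none (prefix-refl w))

  factorization : ∀ {w} → Acc _<_ (length w) → w ∈ S →
    ∃₂ λ x p → x ++ p ≡ w × x ∈ Submonoid X × (∀ {u} → Prefix _≡_ u p → ¬ (u ≢ [] × Even u))
  factorization {w} (acc rec) w∈S with first-code-word w∈S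
  ... | inj₂ none = [] , w , refl , ([] , [] , refl) , none
  ... | inj₁ ([] , _ , _ , []∈X) = contradiction refl (EvenCode.nonempty []∈X)
  ... | inj₁ (x@(_ ∷ x′) , t , refl , x∈X)
    with y , p , refl , (ys , ys⊆X , refl) , none ←
         factorization (rec (s≤s (subst (length t ≤_) (sym (length-++ x′)) (m≤n+m _ _))))
                       (suffix∈S x w∈S)
    = x ++ y , p , ++-assoc x y p , (x ∷ ys , x∈X ∷ ys⊆X , refl) , none

  submonoid-even : ∀ {w} → w ∈ Submonoid X → Even w
  submonoid-even ([]     , []         , refl) = 2 ∣0
  submonoid-even (x ∷ xs , x∈X ∷ xs⊆X , refl) =
    even-++ x (concat xs) (proj₂ (EvenCode.even x∈X)) (submonoid-even (xs , xs⊆X , refl))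

  code-suffix : ∀ {w} → w ∈ S → w ≢ [] → Even w → ∃[ x ] (x ∈ X × Suffix _≡_ x w)
  code-suffix {w} w∈S w≢[] ew with factorization (<-wellFounded _) w∈S
  ... | x , p@(_ ∷ _) , refl , x∈X* , none =
    contradiction ((λ ()) , even-++⁻ʳ x p ew (submonoid-even x∈X*))
                  (none (prefix-refl p))
  ... | x , [] , refl , (xs , xs⊆X , refl) , none
    rewrite ++-identityʳ (concat xs) = last-factor xs xs⊆X w≢[]

  evenCode-isBifix : IsBifixCode X
  evenCode-isBifix = record
    { nonempty   = EvenCode.nonempty
    ; prefixFree = λ x∈X y∈X x<y →
        EvenCode.minimal y∈X x<y (EvenCode.nonempty x∈X) (EvenCode.even x∈X)
    ; suffixFree = suffixFree
    }
    where
    suffixFree : ∀ {x y} → x ∈ X → y ∈ X → ¬ ProperSuffix x y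
    suffixFree {x} x∈X y∈X (x≤y , x≢y) with suffix⇒++ x≤y
    ... | []        , refl = x≢y refl
    ... | c@(_ ∷ _) , refl with y∈S , ey ← EvenCode.even y∈X =
      EvenCode.minimal y∈X (properPrefix-++ c (EvenCode.nonempty x∈X)) (λ ())
        (prefix∈S c y∈S , even-++⁻ˡ c x ey (proj₂ (EvenCode.even x∈X)))

  evenCode-isMaximal : IsRecurrent S → IsMaximalBifixCode S X
  evenCode-isMaximal rec = record
    { isBifixCode = evenCode-isBifix
    ; included    = proj₁ ∘ EvenCode.even
    ; maximal     = maximal
    }
    where
    maximal : ∀ Y → IsBifixCode Y → Y ⊆ S → X ⊆ Y → Y ⊆ X
    maximal Y bifix Y⊆S X⊆Y {y} y∈Y
      with v , _ , yvy∈S ← IsRecurrent.recurrent rec (Y⊆S y∈Y) (Y⊆S y∈Y)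
      with first-code-word yvy∈S
    ... | inj₁ (x , t , eq , x∈X)
      with refl , _ ← split-unique x y eq
             (λ _ xd≡y _ → bifix-split bifix (X⊆Y x∈X) y∈Y xd≡y)
             (λ _ yd≡x _ → bifix-split bifix y∈Y (X⊆Y x∈X) yd≡x)
      = x∈X
    ... | inj₂ none = ⊥-elim even-prefix
      where
      y≢[] : y ≢ []
      y≢[] = IsBifixCode.nonempty bifix y∈Y

      extension≢[] : ∀ (u : List A) {t} → u ≢ [] → u ++ t ≢ []
      extension≢[] []      u≢[] = contradiction refl u≢[]
      extension≢[] (_ ∷ _) _ ()

      even-prefix : _
      even-prefix with even? y | even? (y ++ v)
      ... | yes ey | _ = none (prefix-++ y) (y≢[] , ey)
      ... | no _   | yes eyv =
        none (++⇒prefix (y , ++-assoc y v y)) (extension≢[] y y≢[] , eyv)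
      ... | no oy  | no oyv =
        none (prefix-refl _)
             (extension≢[] y y≢[] , subst Even (++-assoc y v y) (odd-++ (y ++ v) y oyv oy))

  parse-unique : ∀ {w q x p q′ x′ p′} → w ∈ S →
    IsParse X w (q , x , p) → IsParse X w (q′ , x′ , p′) →
    (Even q → Even q′) → (Even q′ → Even q) →
    (q , x , p) ≡ (q′ , x′ , p′)
  parse-unique {w} {q} {x} {p} {q′} {x′} {p′} w∈S t t′ to from =
    cong₂ _,_ (proj₁ q-unique) (cong₂ _,_ (proj₁ x-unique) (proj₂ x-unique))
    where
    module T  = IsParse t
    module T′ = IsParse t′

    q-step : ∀ {q q′ r} → w ≡ q′ ++ r →
      (∀ {s} → Suffix _≡_ s q′ → ¬ (s ∈ X)) →
      (Even q → Even q′) → (Even q′ → Even q) →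
      ∀ d → q ++ d ≡ q′ → d ≡ []
    q-step w≡ noSuffix to from [] _ = refl
    q-step {q} refl noSuffix to from d@(_ ∷ _) refl
      with s , s∈X , s≤d ← code-suffix (suffix∈S q (prefix∈S (q ++ d) w∈S)) (λ ())
                             (even-difference q d to from)
      = contradiction s∈X (noSuffix (q ++ˢ s≤d))

    q-unique : q ≡ q′ × x ++ p ≡ x′ ++ p′
    q-unique = split-unique q q′ (trans (sym T.splits) T′.splits)
      (λ d eq _ → q-step T′.splits T′.noSuffix to from d eq)
      (λ d eq _ → q-step T.splits T.noSuffix from to d eq)

    x-step : ∀ {q x p x′ p′} → w ≡ q ++ x ++ p →
      (∀ {s} → Prefix _≡_ s p → ¬ (s ∈ X)) →
      x ∈ Submonoid X → x′ ∈ Submonoid X →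
      ∀ d → x ++ d ≡ x′ → p ≡ d ++ p′ → d ≡ []
    x-step w≡ noPrefix x∈X* x′∈X* [] _ _ = refl
    x-step {q} {x} {p′ = p′} refl noPrefix x∈X* x′∈X* d@(_ ∷ _) refl refl
      with s , r , eq , s∈X ← code-prefix (prefix∈S d (suffix∈S x (suffix∈S q w∈S))) (λ ())
                               (even-++⁻ʳ x d (submonoid-even x′∈X*) (submonoid-even x∈X*))
      = contradiction s∈X (noPrefix (++⇒prefix (_ , trans (sym (++-assoc s r p′)) (cong (_++ p′) eq))))

    x-unique : x ≡ x′ × p ≡ p′
    x-unique = split-unique x x′ (proj₂ q-unique)
      (x-step {q} T.splits T.noPrefix T.middle T′.middle)
      (x-step {q′} T′.splits T′.noPrefix T′.middle T.middle)

  parse-from : ∀ q {r} → q ++ r ∈ S → (∀ {s} → Suffix _≡_ s q → ¬ (s ∈ X)) →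
    ∃₂ λ x p → IsParse X (q ++ r) (q , x , p)
  parse-from q w∈S noSuffix
    with x , p , refl , x∈X* , none ← factorization (<-wellFounded _) (suffix∈S q w∈S)
    = x , p , record
      { splits   = refl
      ; noSuffix = noSuffix
      ; middle   = x∈X*
      ; noPrefix = λ s≤p s∈X → none s≤p (EvenCode.nonempty s∈X , proj₂ (EvenCode.even s∈X))
      }

  shortest-odd-noSuffix : ∀ {q s} → ¬ Even q → (∀ {u} → ProperPrefix u q → ¬ ¬ Even u) →
    Suffix _≡_ s q → ¬ (s ∈ X)
  shortest-odd-noSuffix {s = s} oq min s≤q s∈X with c , refl ← suffix⇒++ s≤q =
    min (properPrefix-++ c (EvenCode.nonempty s∈X))
        λ ec → oq (even-++ c s ec (proj₂ (EvenCode.even s∈X)))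

  parses : ∀ {w} → w ∈ S →
    HasParses X w 2 ⊎ (HasParses X w 1 × (∀ {u} → Prefix _≡_ u w → Even u))
  parses {w} w∈S
    with x , p , t₀ ← parse-from [] w∈S (λ { (here []) s∈X → EvenCode.nonempty s∈X refl })
    with first-prefix (¬? ∘ even?) w
  ... | inj₂ none = inj₂ ((_ ∷ [] , [] ∷ [] , char , refl) , all-even)
    where
    all-even : ∀ {u} → Prefix _≡_ u w → Even u
    all-even {u} u≤w with even? u
    ... | yes eu = eu
    ... | no ou  = contradiction ou (none u≤w)

    char : ∀ t → _
    char t = mk⇔
      (λ { (Any.here refl) → t₀ })
      (λ t∥ → Any.here (parse-unique w∈S t∥ t₀ (λ _ → 2 ∣0)
        λ _ → all-even {proj₁ t} (++⇒prefix (_ , sym (IsParse.splits t∥)))))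
  ... | inj₁ (q , r , refl , oq , min)
    with x′ , p′ , t₁ ← parse-from q w∈S (shortest-odd-noSuffix oq min)
    = inj₁ (_ ∷ _ ∷ [] , ((λ { refl → oq (2 ∣0) }) ∷ []) ∷ [] ∷ [] , char , refl)
    where
    char : ∀ t → _
    char t = mk⇔
      (λ { (Any.here refl) → t₀ ; (Any.there (Any.here refl)) → t₁ })
      λ t∥ → classify t∥ (even? (proj₁ t))
      where
      classify : IsParse X w t → Dec (Even (proj₁ t)) → _
      classify t∥ (yes e) = Any.here (parse-unique w∈S t∥ t₀ (λ _ → 2 ∣0) (λ _ → e))
      classify t∥ (no o)  = Any.there (Any.here (parse-unique w∈S t∥ t₁
        (λ e → contradiction e o) (λ e → contradiction e oq)))

  left∈tree⇒right∈tree : ∀ a v b {i} → a ∷ v ++ [ b ] ∈ S → All (EvenLetter specular) v →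
    inj₁ a ∈ tree i → inj₂ b ∈ tree i
  left∈tree⇒right∈tree a [] b ab∈S [] a∈i
    with j , b∈j ← cover {inj₂ b} (letter b)
    with refl ← noCrossing a∈i b∈j ab∈S = b∈j
  left∈tree⇒right∈tree a (c ∷ v) b w∈S ((j , c∈j , c∈j′) ∷ ev) a∈i
    with refl ← disjoint c∈j′ (left∈tree⇒right∈tree a [] c (prefix∈S (a ∷ c ∷ []) w∈S) [] a∈i)
    = left∈tree⇒right∈tree c v b (suffix∈S [ a ] w∈S) ev c∈j

  letter-of-tree : ∀ i → ∃ (OddLetter specular) ⊎ ∃[ a ] (inj₁ a ∈ tree i × inj₂ a ∈ tree i)
  letter-of-tree i with IsTree.nonempty (isTree i)
  ... | inj₁ a , a∈i with evenLetter? specular a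
  ...   | no  o = inj₁ (a , o)
  ...   | yes (j , a∈j , a∈j′) with refl ← disjoint a∈i a∈j = inj₂ (a , a∈j , a∈j′)
  letter-of-tree i | inj₂ a , a∈i with evenLetter? specular a
  ...   | no  o = inj₁ (a , o)
  ...   | yes (j , a∈j , a∈j′) with refl ← disjoint a∈i a∈j′ = inj₂ (a , a∈j , a∈j′)

  odd-letter : IsRecurrent S → ∃ (OddLetter specular)
  odd-letter rec with letter-of-tree zero | letter-of-tree (suc zero)
  ... | inj₁ odd | _        = odd
  ... | inj₂ _   | inj₁ odd = odd
  ... | inj₂ (a , a∈0 , _) | inj₂ (b , _ , b∈1)
    with v , _ , avb∈S ← IsRecurrent.recurrent rec (letter a) (letter b)
    with all? (evenLetter? specular) v
  ... | no ¬ev = Any.satisfied (¬All⇒Any¬ (evenLetter? specular) v ¬ev)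
  ... | yes ev = contradiction (disjoint (left∈tree⇒right∈tree a v b avb∈S ev a∈0) b∈1) λ ()

  evenCode-hasDegree-2 : IsRecurrent S → HasDegree S X 2
  evenCode-hasDegree-2 rec = record { bounded = bounded ; attained = attained }
    where
    bounded : ∀ {w} → w ∈ S → ∃[ k ] (HasParses X w k × k ≤ 2)
    bounded w∈S with parses w∈S
    ... | inj₁ two       = 2 , two , s≤s (s≤s z≤n)
    ... | inj₂ (one , _) = 1 , one , s≤s z≤n

    attained : ∃[ w ] (w ∈ S × HasParses X w 2)
    attained with a , odd ← odd-letter rec with parses (letter a)
    ... | inj₁ two = [ a ] , letter a , two
    ... | inj₂ (_ , all-even) = contradiction
      (∣1⇒≡1 (subst (2 ∣_) (cong length (filter-accept odd? odd)) (all-even (prefix-++ [ a ]))))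
      λ ()

proposition4p8 : {A : Set} {n : ℕ} → A ↔ Fin n →
    (θ : A → A) → Involutive _≡_ θ →
    (S : Pred (List A) 0ℓ) (specular : IsSpecular θ S) → IsRecurrent S →
    IsMaximalBifixCode S (EvenCode specular) × HasDegree S (EvenCode specular) 2
proposition4p8 _ θ _ S specular rec =
  evenCode-isMaximal specular rec , evenCode-hasDegree-2 specular rec
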